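{- For any graph $G$ with no isolated vertex and any noncomplete graph $H$ with $\gamma(H)=1$, $\gamma_{(1,0,0)}^s(G\circ H)=\gamma_{(2,1,0)}(G)$.
   Context: All graphs are finite and simple; $\gamma(H)$ is the domination number; $N(v)$ is the open neighbourhood. For an integer $l\ge1$ and $w=(w_0,\dots,w_l)$ with $w_0\ge1$, $w_i\ge0$ integers, a function $f:V(G)\to\{0,\dots,l\}$ is a $w$-dominating function if $\sum_{u\in N(v)}f(u)\ge w_i$ for every vertex $v$ with $f(v)=i$; its weight is $\sum_v f(v)$, and $\gamma_w(G)$ is the minimum weight of a $w$-dominating function. For adjacent $v,u$ with $f(v)=0$, $f(u)>0$, $f_{u\to v}$ is defined by $f_{u\to v}(v)=1$, $f_{u\to v}(u)=f(u)-1$, $f_{u\to v}(x)=f(x)$ otherwise. A $w$-dominating $f$ is secure if for every $v$ with $f(v)=0$ there is $u\in N(v)$ with $f(u)>0$ such that $f_{u\to v}$ is $w$-dominating; $\gamma_w^s(G)$ is the minimum weight of a secure $w$-dominating function. The lexicographic product $G\circ H$ has vertex set $V(G)\times V(H)$, with $(u,v)(x,y)$ an edge iff $ux\in E(G)$, or $u=x$ and $vy\in E(H)$. -}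

module Defs where

open import Algebra.Properties.CommutativeMonoid.Sum using (sum)
open import Data.Bool.Base using (if_then_else_)
open import Data.Fin.Base as Fin using (Fin; zero; suc; toℕ; pred)
open import Data.Fin.Properties using (*↔×; inj⇒≟)
open import Data.Fin.Subset using (Subset; ∣_∣; _∈_; _∉_)
open import Data.Nat.Base using (ℕ; _+_; _*_; _≤_; _≥_)
open import Data.Nat.Properties using (+-0-commutativeMonoid)
open import Data.Product.Base using (∃-syntax; _×_; _,_)
open import Data.Product.Function.NonDependent.Propositional using (_×-↔_)
open import Data.Sum.Base using (_⊎_; inj₁; inj₂)
open import Data.Vec.Base using (Vec; lookup)
open import Function.Bundles using (_↔_; Inverse)
open import Function.Properties.Inverse using (↔-sym; ↔-trans; ↔⇒↣)
open import Level using (0ℓ)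
open import Relation.Binary.Core using (Rel)
open import Relation.Binary.Definitions using (Decidable; DecidableEquality; Irreflexive; Symmetric)
open import Relation.Binary.PropositionalEquality.Core using (_≡_; _≢_; refl; sym)
open import Relation.Nullary.Decidable using (⌊_⌋; _×-dec_; _⊎-dec_)

-- The null graph (order 0) is allowed.
record Graph : Set₁ where
  infix 4 _~_ _~?_ _≟_
  field
    V       : Set
    order   : ℕ
    finite  : V ↔ Fin order
    _~_     : Rel V 0ℓ
    _~?_    : Decidable _~_
    ~-sym   : Symmetric _~_
    ~-irrefl : Irreflexive _≡_ _~_

  index : V → Fin order
  index = Inverse.to finite

  vertex : Fin order → V
  vertex = Inverse.from finite

  _≟_ : DecidableEquality V
  _≟_ = inj⇒≟ (↔⇒↣ finite)

  ∑V : (V → ℕ) → ℕ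
  ∑V f = sum +-0-commutativeMonoid (λ i → f (vertex i))

  ∑N : V → (V → ℕ) → ℕ
  ∑N v f = ∑V (λ u → if ⌊ v ~? u ⌋ then f u else 0)

open Graph using (V)

NoIsolatedVertex : Graph → Set
NoIsolatedVertex G = ∀ v → ∃[ u ] v ~ u
  where open Graph G

Complete : Graph → Set
Complete G = ∀ u v → u ≢ v → u ~ v
  where open Graph G

infixr 7 _∘ₗ_

_∘ₗ_ : Graph → Graph → Graph
G ∘ₗ H = record
  { V        = G.V × H.V
  ; order    = G.order * H.order
  ; finite   = ↔-trans (G.finite ×-↔ H.finite) (↔-sym *↔×)
  ; _~_      = λ (u , v) (x , y) → u G.~ x ⊎ (u ≡ x × v H.~ y)
  ; _~?_     = λ (u , v) (x , y) → (u G.~? x) ⊎-dec ((u G.≟ x) ×-dec (v H.~? y))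
  ; ~-sym    = λ { (inj₁ p) → inj₁ (G.~-sym p)
                 ; (inj₂ (e , p)) → inj₂ (sym e , H.~-sym p) }
  ; ~-irrefl = λ { refl (inj₁ p) → G.~-irrefl refl p
                 ; refl (inj₂ (_ , p)) → H.~-irrefl refl p }
  }
  where
  module G = Graph G
  module H = Graph H

-- k is the minimum of the cost c over the elements satisfying P (attained).
IsMinimum : {A : Set} → (A → Set) → (A → ℕ) → ℕ → Set
IsMinimum {A} P c k = (∃[ a ] (P a × c a ≡ k)) × (∀ (a : A) → P a → k ≤ c a)

module _ (G : Graph) where
  open Graph G hiding (V)

  -- Vertex sets are given through the enumeration of V G.
  Dominating : Subset order → Set
  Dominating S = ∀ v → index v ∉ S → ∃[ u ] (v ~ u × index u ∈ S)

  -- γ(G) = k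
  IsDominationNumber : ℕ → Set
  IsDominationNumber = IsMinimum Dominating ∣_∣

  weight : ∀ {n} → (V G → Fin n) → ℕ
  weight f = ∑V (λ v → toℕ (f v))

  -- f_{u→v}; only meaningful for u ~ v, f v = 0 and f u > 0.
  move : ∀ {k} → (V G → Fin (2 + k)) → (u v : V G) → V G → Fin (2 + k)
  move f u v x =
    if ⌊ x ≟ v ⌋ then suc zero
    else if ⌊ x ≟ u ⌋ then pred (f u)
    else f x

  -- Here l = 1 + k, so that l ≥ 1; w₀ ≥ 1 is not imposed on w, as the
  -- definitions make sense without it.
  module _ {k} (w : Vec ℕ (2 + k)) where

    WDominating : (V G → Fin (2 + k)) → Set
    WDominating f = ∀ v → ∑N v (λ u → toℕ (f u)) ≥ lookup w (f v)

    SecureWDominating : (V G → Fin (2 + k)) → Set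
    SecureWDominating f =
      WDominating f ×
      (∀ v → f v ≡ zero →
        ∃[ u ] (v ~ u × zero {1 + k} Fin.< f u × WDominating (move f u v)))

    -- γ_w(G) = m
    IsWDominationNumber : ℕ → Set
    IsWDominationNumber = IsMinimum WDominating weight

    -- γ_w^s(G) = m
    IsSecureWDominationNumber : ℕ → Set
    IsSecureWDominationNumber = IsMinimum SecureWDominating weight

{-# OPTIONS --safe #-}
-- For w = (2,1,0) the condition at v says exactly that the closed neighbourhood
-- N[v] carries total weight at least 2, i.e. two units of weight ("tokens").
--
-- Upper bound: put g on G × {c}, with c a universal vertex of H.  After moving
-- one token out of (a, c), each N[z] still contains a vertex z' with (z', c)
-- positive, and this vertex dominates the whole layer over z.
--
-- Lower bound: cap the layer sums of a secure f at 2.  If the layers over N[u]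
-- carried at most one token, any v ≠ v' in H would be adjacent: if (u, v) is
-- empty, its defender moves the only token to (u, v), and otherwise the only
-- token is at (u, v) already; in both cases it is what dominates (u, v').
module Submission where

open import Defs
open import Algebra.Properties.CommutativeMonoid.Sum using (sum)
open import Data.Bool.Base using (if_then_else_)
open import Data.Fin.Base as Fin using (Fin; zero; suc; toℕ; combine; _↑ˡ_; _↑ʳ_; finToFun; funToFin)
open import Data.Fin.Properties as Fin using (remQuot-combine; finToFun-funToFin; any?; all?)
open import Data.Fin.Subset using (Subset; ∣_∣; _∈_; inside; outside)
open import Data.Fin.Subset.Properties using (x∈p⇒∣p-x∣<∣p∣)
open import Data.Nat.Base using (ℕ; zero; suc; _+_; _*_; _^_; _≤_; _<_; z≤n; s≤s; s≤s⁻¹)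
open import Data.Nat.Induction using (<-wellFounded)
open import Data.Nat.Properties as ℕ using (+-0-commutativeMonoid)
open import Data.Product.Base using (∃-syntax; _×_; _,_; proj₁)
open import Data.Sum.Base using (_⊎_; inj₁; inj₂)
open import Data.Vec.Base using (Vec; _∷_; []; lookup; here; there)
open import Function.Base using (_∘_; _$_)
open import Function.Bundles using (Inverse)
open import Induction.WellFounded using (Acc; acc)
open import Relation.Binary.PropositionalEquality.Core using (_≡_; _≢_; _≗_; refl; sym; trans; cong; cong₂; subst)
open import Relation.Nullary.Decidable using (Dec; yes; no; ⌊_⌋; map′; _×-dec_)
open import Relation.Nullary.Negation.Core using (¬_; contradiction)

open import Algebra.Properties.CommutativeMonoid.Sum +-0-commutativeMonoid
  using (sum-cong-≗; sum-replicate-zero; ∑-distrib-+)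

open Graph using (V)

-- Sums of naturals over finite index sets.

∑ : ∀ {n} → (Fin n → ℕ) → ℕ
∑ = sum +-0-commutativeMonoid

∑-mono : ∀ {n} {s t : Fin n → ℕ} → (∀ i → s i ≤ t i) → ∑ s ≤ ∑ t
∑-mono {zero}  s≤t = z≤n
∑-mono {suc n} s≤t = ℕ.+-mono-≤ (s≤t zero) (∑-mono (s≤t ∘ suc))

term≤∑ : ∀ {n} (t : Fin n → ℕ) i → t i ≤ ∑ t
term≤∑ t zero    = ℕ.m≤m+n _ _
term≤∑ t (suc i) = ℕ.≤-trans (term≤∑ (t ∘ suc) i) (ℕ.m≤n+m _ _)

∑-support : ∀ {n} (t : Fin n → ℕ) i → (∀ j → j ≢ i → t j ≡ 0) → ∑ t ≡ t i
∑-support {suc n} t zero    t≡0 =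
  trans (cong (t zero +_) (trans (sum-cong-≗ (λ j → t≡0 (suc j) λ ())) (sum-replicate-zero n)))
        (ℕ.+-identityʳ _)
∑-support {suc n} t (suc i) t≡0 =
  cong₂ _+_ (t≡0 zero λ ()) (∑-support (t ∘ suc) i λ j j≢i → t≡0 (suc j) (j≢i ∘ Fin.suc-injective))

∑-positive : ∀ {n} (t : Fin n → ℕ) → 1 ≤ ∑ t → ∃[ i ] 1 ≤ t i
∑-positive {suc n} t 1≤∑ with t zero in eq
... | suc _ = zero , subst (1 ≤_) (sym eq) (s≤s z≤n)
... | zero  with i , 1≤t ← ∑-positive (t ∘ suc) 1≤∑ = suc i , 1≤t

∑-++ : ∀ m n (t : Fin (m + n) → ℕ) → ∑ t ≡ ∑ (λ i → t (i ↑ˡ n)) + ∑ (λ j → t (m ↑ʳ j))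
∑-++ zero    n t = refl
∑-++ (suc m) n t = trans (cong (t zero +_) (∑-++ m n (t ∘ suc))) (sym (ℕ.+-assoc (t zero) _ _))

∑-combine : ∀ m n (t : Fin (m * n) → ℕ) → ∑ t ≡ ∑ (λ i → ∑ (λ j → t (combine {m} i j)))
∑-combine zero    n t = refl
∑-combine (suc m) n t =
  trans (∑-++ n (m * n) t) (cong (∑ (λ j → t (j ↑ˡ m * n)) +_) (∑-combine m n (λ k → t (n ↑ʳ k))))

-- The two positions may coincide, but then that entry has to hold both units. Unlike a bound on a
-- sum, this form says where the weight sits, so tokens can be followed through moves and
-- projections.
TwoTokens : {A : Set} → (A → ℕ) → Set
TwoTokens h = ∃[ a ] ∃[ b ] (1 ≤ h a × 1 ≤ h b × (a ≡ b → 2 ≤ h a))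

∑≥2⇒TwoTokens : ∀ {n} (t : Fin n → ℕ) → 2 ≤ ∑ t → TwoTokens t
∑≥2⇒TwoTokens {suc n} t 2≤∑ with t zero in eq
... | suc (suc _) = zero , zero , positive , positive , λ _ → subst (2 ≤_) (sym eq) (s≤s (s≤s z≤n))
  where
  positive : 1 ≤ t zero
  positive = subst (1 ≤_) (sym eq) (s≤s z≤n)
... | suc zero
  with i , 1≤t ← ∑-positive (t ∘ suc) (s≤s⁻¹ 2≤∑) =
  zero , suc i , subst (1 ≤_) (sym eq) (s≤s z≤n) , 1≤t , λ ()
... | zero
  with i , j , 1≤tᵢ , 1≤tⱼ , far ← ∑≥2⇒TwoTokens (t ∘ suc) 2≤∑ =
  suc i , suc j , 1≤tᵢ , 1≤tⱼ , far ∘ Fin.suc-injective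

TwoTokens⇒∑≥2 : ∀ {n} (t : Fin n → ℕ) → TwoTokens t → 2 ≤ ∑ t
TwoTokens⇒∑≥2 t (zero  , zero  , _    , _    , far) = ℕ.≤-trans (far refl) (term≤∑ t zero)
TwoTokens⇒∑≥2 t (zero  , suc j , 1≤tᵢ , 1≤tⱼ , _) = ℕ.+-mono-≤ 1≤tᵢ (ℕ.≤-trans 1≤tⱼ (term≤∑ (t ∘ suc) j))
TwoTokens⇒∑≥2 t (suc i , zero  , 1≤tᵢ , 1≤tⱼ , _) = ℕ.+-mono-≤ 1≤tⱼ (ℕ.≤-trans 1≤tᵢ (term≤∑ (t ∘ suc) i))
TwoTokens⇒∑≥2 t (suc i , suc j , 1≤tᵢ , 1≤tⱼ , far) =
  ℕ.≤-trans (TwoTokens⇒∑≥2 (t ∘ suc) (i , j , 1≤tᵢ , 1≤tⱼ , far ∘ cong suc)) (ℕ.m≤n+m _ _)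

-- Sums over the vertices of a graph.

module _ (G : Graph) where
  open Graph G hiding (V)

  vertex-index : ∀ v → vertex (index v) ≡ v
  vertex-index = Inverse.strictlyInverseʳ finite

  index-vertex : ∀ i → index (vertex i) ≡ i
  index-vertex = Inverse.strictlyInverseˡ finite

  vertex-injective : ∀ {i j} → vertex i ≡ vertex j → i ≡ j
  vertex-injective {i} {j} eq = trans (sym (index-vertex i)) (trans (cong index eq) (index-vertex j))

  ∑V-cong : {h k : V G → ℕ} → h ≗ k → ∑V h ≡ ∑V k
  ∑V-cong h≗k = sum-cong-≗ (h≗k ∘ vertex)

  term≤∑V : ∀ (h : V G → ℕ) v → h v ≤ ∑V h
  term≤∑V h v = subst (λ x → h x ≤ ∑V h) (vertex-index v) (term≤∑ (h ∘ vertex) (index v))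

  ∑V-support : ∀ (h : V G → ℕ) v → (∀ u → u ≢ v → h u ≡ 0) → ∑V h ≡ h v
  ∑V-support h v h≡0 = trans
    (∑-support (h ∘ vertex) (index v) λ j j≢v →
      h≡0 (vertex j) λ eq → j≢v (trans (sym (index-vertex j)) (cong index eq)))
    (cong h (vertex-index v))

  ∑V-positive : ∀ (h : V G → ℕ) → 1 ≤ ∑V h → ∃[ v ] 1 ≤ h v
  ∑V-positive h 1≤∑ with i , 1≤h ← ∑-positive (h ∘ vertex) 1≤∑ = vertex i , 1≤h

  ∑V≥2⇒TwoTokens : ∀ (h : V G → ℕ) → 2 ≤ ∑V h → TwoTokens h
  ∑V≥2⇒TwoTokens h 2≤∑ with i , j , 1≤hᵢ , 1≤hⱼ , far ← ∑≥2⇒TwoTokens (h ∘ vertex) 2≤∑ =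
    vertex i , vertex j , 1≤hᵢ , 1≤hⱼ , far ∘ vertex-injective

  TwoTokens⇒∑V≥2 : ∀ (h : V G → ℕ) → TwoTokens h → 2 ≤ ∑V h
  TwoTokens⇒∑V≥2 h (a , b , 1≤ha , 1≤hb , far) = TwoTokens⇒∑≥2 (h ∘ vertex)
    ( index a , index b , at a 1≤ha , at b 1≤hb
    , λ eq → at a (far (trans (sym (vertex-index a)) (trans (cong vertex eq) (vertex-index b)))))
    where
    at : ∀ {n} x → n ≤ h x → n ≤ h (vertex (index x))
    at {n} x = subst (λ y → n ≤ h y) (sym (vertex-index x))

  -- Closed neighbourhoods and the tokens in them.

  infix 4 _∈N[_]

  _∈N[_] : V G → V G → Set
  x ∈N[ u ] = u ≡ x ⊎ u ~ x

  TwoTokensNear : V G → (V G → ℕ) → Set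
  TwoTokensNear u h =
    ∃[ a ] ∃[ b ] (a ∈N[ u ] × b ∈N[ u ] × 1 ≤ h a × 1 ≤ h b × (a ≡ b → 2 ≤ h a))

  -- The restriction of `h` to N[u], extended by zero. Since there are no loops, at most one of the
  -- two summands is nonzero.
  near : V G → (V G → ℕ) → V G → ℕ
  near u h x = (if ⌊ u ≟ x ⌋ then h x else 0) + (if ⌊ u ~? x ⌋ then h x else 0)

  ∑V-near : ∀ u h → ∑V (near u h) ≡ h u + ∑N u h
  ∑V-near u h = trans
    (∑-distrib-+ (self ∘ vertex) (λ i → if ⌊ u ~? vertex i ⌋ then h (vertex i) else 0))
    (cong (_+ ∑N u h) (trans (∑V-support self u off) on))
    where
    self : V G → ℕ
    self x = if ⌊ u ≟ x ⌋ then h x else 0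
    off : ∀ x → x ≢ u → self x ≡ 0
    off x x≢u with u ≟ x
    ... | yes u≡x = contradiction (sym u≡x) x≢u
    ... | no  _   = refl
    on : self u ≡ h u
    on with u ≟ u
    ... | yes _   = refl
    ... | no  u≢u = contradiction refl u≢u

  near-∈ : ∀ u h x → x ∈N[ u ] → near u h x ≡ h x
  near-∈ u h x x∈ with u ≟ x | u ~? x
  ... | yes u≡x | yes u~x = contradiction u~x (~-irrefl u≡x)
  ... | yes _   | no  _   = ℕ.+-identityʳ _
  ... | no  _   | yes _   = refl
  near-∈ u h x (inj₁ u≡x) | no u≢x | no _    = contradiction u≡x u≢x
  near-∈ u h x (inj₂ u~x) | no _   | no ¬u~x = contradiction u~x ¬u~x

  near-positive : ∀ u h x → 1 ≤ near u h x → x ∈N[ u ]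
  near-positive u h x 1≤ with u ≟ x | u ~? x
  ... | yes u≡x | _       = inj₁ u≡x
  ... | no  _   | yes u~x = inj₂ u~x
  near-positive u h x () | no _ | no _

  closed-sum≥2⇒TwoTokensNear : ∀ u h → 2 ≤ h u + ∑N u h → TwoTokensNear u h
  closed-sum≥2⇒TwoTokensNear u h 2≤
    with a , b , 1≤a , 1≤b , far ← ∑V≥2⇒TwoTokens (near u h) (subst (2 ≤_) (sym (∑V-near u h)) 2≤) =
    let a∈ = near-positive u h a 1≤a
        b∈ = near-positive u h b 1≤b
    in a , b , a∈ , b∈ , subst (1 ≤_) (near-∈ u h a a∈) 1≤a , subst (1 ≤_) (near-∈ u h b b∈) 1≤b ,
       subst (2 ≤_) (near-∈ u h a a∈) ∘ far

  TwoTokensNear⇒closed-sum≥2 : ∀ u h → TwoTokensNear u h → 2 ≤ h u + ∑N u h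
  TwoTokensNear⇒closed-sum≥2 u h (a , b , a∈ , b∈ , 1≤a , 1≤b , far) =
    subst (2 ≤_) (∑V-near u h) $ TwoTokens⇒∑V≥2 (near u h)
      (a , b , up a∈ 1≤a , up b∈ 1≤b , up a∈ ∘ far)
    where
    up : ∀ {n x} → x ∈N[ u ] → n ≤ h x → n ≤ near u h x
    up {n} x∈ = subst (n ≤_) (sym (near-∈ u h _ x∈))

  ∑N-positive : ∀ v h → 1 ≤ ∑N v h → ∃[ u ] (v ~ u × 1 ≤ h u)
  ∑N-positive v h 1≤∑ with ∑V-positive (λ u → if ⌊ v ~? u ⌋ then h u else 0) 1≤∑
  ... | u , 1≤h with v ~? u
  ...   | yes v~u = u , v~u , 1≤h
  ∑N-positive v h 1≤∑ | u , () | no _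

  term≤∑N : ∀ {v u} h → v ~ u → h u ≤ ∑N v h
  term≤∑N {v} {u} h v~u with v ~? u | term≤∑V (λ x → if ⌊ v ~? x ⌋ then h x else 0) u
  ... | yes _    | hu≤ = hu≤
  ... | no  ¬v~u | _   = contradiction v~u ¬v~u

  -- The entry of (2,1,0) at `i` is 2 - i, so adding `f v` turns all three demands into the same
  -- bound 2.
  210-dominating⇒TwoTokensNear : ∀ (f : V G → Fin 3) → WDominating G (2 ∷ 1 ∷ 0 ∷ []) f →
    ∀ v → TwoTokensNear v (toℕ ∘ f)
  210-dominating⇒TwoTokensNear f dom v = closed-sum≥2⇒TwoTokensNear v (toℕ ∘ f) (closed (f v) (dom v))
    where
    closed : ∀ (i : Fin 3) {s} → lookup (2 ∷ 1 ∷ 0 ∷ []) i ≤ s → 2 ≤ toℕ i + s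
    closed zero             p = p
    closed (suc zero)       p = s≤s p
    closed (suc (suc zero)) p = s≤s (s≤s p)

  TwoTokensNear⇒210-dominating : ∀ (f : V G → Fin 3) → (∀ v → TwoTokensNear v (toℕ ∘ f)) →
    WDominating G (2 ∷ 1 ∷ 0 ∷ []) f
  TwoTokensNear⇒210-dominating f two v = opened (f v) (TwoTokensNear⇒closed-sum≥2 v (toℕ ∘ f) (two v))
    where
    opened : ∀ (i : Fin 3) {s} → 2 ≤ toℕ i + s → lookup (2 ∷ 1 ∷ 0 ∷ []) i ≤ s
    opened zero             p             = p
    opened (suc zero)       (s≤s p)       = p
    opened (suc (suc zero)) (s≤s (s≤s p)) = p

  -- A vertex of positive value is its own token; only at value 0 does the vector ask for a positive
  -- neighbour.
  100-dominating⇒TokenNear : ∀ (f : V G → Fin 3) → WDominating G (1 ∷ 0 ∷ 0 ∷ []) f →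
    ∀ v → ∃[ u ] (u ∈N[ v ] × 1 ≤ toℕ (f u))
  100-dominating⇒TokenNear f dom v with f v in eq | dom v
  ... | suc _ | _   = v , inj₁ refl , subst (λ i → 1 ≤ toℕ i) (sym eq) (s≤s z≤n)
  ... | zero  | 1≤∑ with u , v~u , 1≤fu ← ∑N-positive v (toℕ ∘ f) 1≤∑ = u , inj₂ v~u , 1≤fu

  TokenNear⇒100-dominating : ∀ (f : V G → Fin 3) → (∀ v → ∃[ u ] (u ∈N[ v ] × 1 ≤ toℕ (f u))) →
    WDominating G (1 ∷ 0 ∷ 0 ∷ []) f
  TokenNear⇒100-dominating f token v with f v in eq | token v
  ... | suc zero       | _ = z≤n
  ... | suc (suc zero) | _ = z≤n
  ... | zero | u , inj₂ v~u  , 1≤fu = ℕ.≤-trans 1≤fu (term≤∑N (toℕ ∘ f) v~u)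
  ... | zero | u , inj₁ refl , 1≤fu = contradiction (subst (λ i → 1 ≤ toℕ i) eq 1≤fu) λ ()

  -- A source still positive after giving up a token must have held two. The clause for `x ≡ u` has
  -- the shape used in `TwoTokens`, so `x` and a positive source `u` count as two tokens of `f` even
  -- when they are equal.
  move-positive⇒ : ∀ (f : V G → Fin 3) u v x → 1 ≤ toℕ (move G f u v x) →
    x ≡ v ⊎ (1 ≤ toℕ (f x) × (x ≡ u → 2 ≤ toℕ (f x)))
  move-positive⇒ f u v x 1≤ with x ≟ v
  ... | yes x≡v = inj₁ x≡v
  ... | no  _   with x ≟ u
  ...   | no  x≢u  = inj₂ (1≤ , λ x≡u → contradiction x≡u x≢u)
  ...   | yes refl with f u
  ...     | suc (suc zero) = inj₂ (s≤s z≤n , λ _ → s≤s (s≤s z≤n))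
  move-positive⇒ f u v x () | no _ | yes refl | zero
  move-positive⇒ f u v x () | no _ | yes refl | suc zero

  ⇒move-positive : ∀ (f : V G → Fin 3) u v x → 1 ≤ toℕ (f x) → (x ≡ u → 2 ≤ toℕ (f x)) →
    1 ≤ toℕ (move G f u v x)
  ⇒move-positive f u v x 1≤ 2≤ with x ≟ v
  ... | yes _ = s≤s z≤n
  ... | no  _ with x ≟ u
  ...   | no  _    = 1≤
  ...   | yes refl with f u | 2≤ refl
  ...     | suc (suc zero) | _      = s≤s z≤n
  ...     | suc zero       | s≤s ()

  -- Decidability and the existence of a minimum.

  WDominating-resp-≗ : ∀ {k} (w : Vec ℕ (2 + k)) {f g} → f ≗ g → WDominating G w f → WDominating G w g
  WDominating-resp-≗ w {f} {g} f≗g dom v rewrite sym (f≗g v) = ℕ.≤-trans (dom v) (ℕ.≤-reflexive eq)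
    where
    eq : ∑N v (toℕ ∘ f) ≡ ∑N v (toℕ ∘ g)
    eq = ∑V-cong λ u → cong (λ n → if ⌊ v ~? u ⌋ then n else 0) (cong toℕ (f≗g u))

  WDominating? : ∀ {k} (w : Vec ℕ (2 + k)) f → Dec (WDominating G w f)
  WDominating? w f = map′ (λ dom v → subst Q (vertex-index v) (dom (index v))) (λ dom i → dom (vertex i))
    (all? λ i → lookup w (f (vertex i)) ℕ.≤? ∑N (vertex i) (toℕ ∘ f))
    where
    Q : V G → Set
    Q v = lookup w (f v) ≤ ∑N v (toℕ ∘ f)

  -- Colourings are coded by numbers below `k ^ order`, which makes the search finite. Decoding
  -- recovers a colouring only up to pointwise equality, hence `resp`.
  ∃-coloring? : ∀ {k} {P : (V G → Fin k) → Set} → (∀ {f g} → f ≗ g → P f → P g) →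
    (∀ f → Dec (P f)) → Dec (∃[ f ] P f)
  ∃-coloring? {k} resp P? = map′ (λ (c , p) → decode c , p) (λ (f , p) → encode f , resp (decode-encode f) p)
    (any? (P? ∘ decode))
    where
    decode : Fin (k ^ order) → V G → Fin k
    decode c v = finToFun c (index v)
    encode : (V G → Fin k) → Fin (k ^ order)
    encode f = funToFin (f ∘ vertex)
    decode-encode : ∀ f → f ≗ decode (encode f)
    decode-encode f v = sym (trans (finToFun-funToFin (f ∘ vertex) (index v)) (cong f (vertex-index v)))

-- Pass to a strictly cheaper solution as long as there is one. Well-foundedness of `_<_` ends the
-- descent, and the failed last search is exactly minimality.
minimum : {A : Set} {P : A → Set} (c : A → ℕ) → (∀ m → Dec (∃[ a ] (P a × c a < m))) →
  ∃[ a ] P a → ∃[ k ] IsMinimum P c k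
minimum {A} {P} c smaller? (a₀ , p₀) = descend a₀ p₀ (<-wellFounded (c a₀))
  where
  descend : ∀ a → P a → Acc _<_ (c a) → ∃[ k ] IsMinimum P c k
  descend a p (acc rec) with smaller? (c a)
  ... | yes (b , q , b<a) = descend b q (rec b<a)
  ... | no  none          = c a , (a , p , refl) , λ b q → ℕ.≮⇒≥ λ b<a → none (b , q , b<a)

-- The theorem claims a common value of two minima, so one of them has to be shown to exist; this
-- one supplies the value.
210-domination-number : ∀ G → ∃[ m ] IsWDominationNumber G (2 ∷ 1 ∷ 0 ∷ []) m
210-domination-number G = minimum (weight G)
  (λ m → ∃-coloring? G
    (λ f≗g (dom , lt) → WDominating-resp-≗ G w f≗g dom ,
      ℕ.≤-<-trans (ℕ.≤-reflexive (∑V-cong G λ v → cong toℕ (sym (f≗g v)))) lt)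
    (λ f → WDominating? G w f ×-dec (weight G f ℕ.<? m)))
  -- The constant function 2 is always admissible, because the demand at value 2 is 0.
  ((λ _ → suc (suc zero)) , λ _ → z≤n)
  where
  w : Vec ℕ 3
  w = 2 ∷ 1 ∷ 0 ∷ []

-- A universal vertex from domination number one.

∣p∣≡1⇒singleton : ∀ {n} (p : Subset n) → ∣ p ∣ ≡ 1 → ∃[ i ] (∀ {j} → j ∈ p → j ≡ i)
∣p∣≡1⇒singleton (inside ∷ p) eq = zero , λ where
  here       → refl
  -- The tail has size 0, yet removing a member would make it strictly smaller.
  (there j∈) → contradiction
    (ℕ.<-≤-trans (x∈p⇒∣p-x∣<∣p∣ j∈) (ℕ.≤-reflexive (ℕ.suc-injective eq))) λ ()
∣p∣≡1⇒singleton (outside ∷ p) eq with i , unique ← ∣p∣≡1⇒singleton p eq =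
  suc i , λ { (there j∈) → cong suc (unique j∈) }

-- Any vertex other than the single member of the dominating set lies outside the set, so that
-- member is what dominates it.
universal-vertex : ∀ H → IsDominationNumber H 1 → ∃[ c ] (∀ y → _∈N[_] H c y)
universal-vertex H ((S , dom , ∣S∣≡1) , _) with ∣p∣≡1⇒singleton S ∣S∣≡1
... | i , unique = vertex i , near-center
  where
  open Graph H
  near-center : ∀ y → _∈N[_] H (vertex i) y
  near-center y with y ≟ vertex i
  ... | yes y≡c = inj₁ y≡c
  ... | no  y≢c
    with u , y~u , u∈S ← dom y (λ y∈S →
      y≢c (trans (sym (vertex-index H y)) (cong vertex (unique y∈S)))) =
    inj₂ (subst (y ~_) (trans (sym (vertex-index H u)) (cong vertex (unique u∈S))) y~u)

-- Sums over the layers of the lexicographic product.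

module _ (G H : Graph) where
  private
    module G = Graph G
    module H = Graph H
    module GH = Graph (G ∘ₗ H)

  -- The vertices of the product are enumerated through `remQuot`, which undoes `combine`; each
  -- block of indices is therefore one layer.
  ∑V-∘ₗ : ∀ h → GH.∑V h ≡ G.∑V (λ x → H.∑V (λ y → h (x , y)))
  ∑V-∘ₗ h = trans (∑-combine G.order H.order (h ∘ GH.vertex))
    (sum-cong-≗ λ i → sum-cong-≗ λ j →
      cong (λ (k , l) → h (G.vertex k , H.vertex l)) (remQuot-combine {G.order} i j))

  -- Upper bound: a function on `G` placed on the centres of the layers.

  module Lift (c : V H) (universal : ∀ y → _∈N[_] H c y) (g : V G → Fin 3) where

    lift : V (G ∘ₗ H) → Fin 3
    lift (x , y) = if ⌊ y H.≟ c ⌋ then g x else zero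

    lift-center : ∀ x → lift (x , c) ≡ g x
    lift-center x with c H.≟ c
    ... | yes _   = refl
    ... | no  c≢c = contradiction refl c≢c

    weight-lift : weight (G ∘ₗ H) lift ≡ weight G g
    weight-lift = trans (∑V-∘ₗ (toℕ ∘ lift)) $ ∑V-cong G λ x →
      trans (∑V-support H (λ y → toℕ (lift (x , y))) c (off x)) (cong toℕ (lift-center x))
      where
      off : ∀ x y → y ≢ c → toℕ (lift (x , y)) ≡ 0
      off x y y≢c with y H.≟ c
      ... | yes y≡c = contradiction y≡c y≢c
      ... | no  _   = refl

    -- Layers over adjacent vertices are completely joined, and inside its own layer the centre
    -- reaches everything because `c` is universal.
    center-near : ∀ {x a} y → _∈N[_] G a x → _∈N[_] (G ∘ₗ H) (a , c) (x , y)
    center-near y (inj₂ x~a)  = inj₂ (inj₁ x~a)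
    center-near y (inj₁ refl) with universal y
    ... | inj₁ refl = inj₁ refl
    ... | inj₂ y~c  = inj₂ (inj₂ (refl , y~c))

    positive-at-center : ∀ {n a} → n ≤ toℕ (g a) → n ≤ toℕ (lift (a , c))
    positive-at-center {n} {a} = subst (λ i → n ≤ toℕ i) (sym (lift-center a))

    centers-dominate : ∀ f → (∀ x → ∃[ a ] (_∈N[_] G a x × 1 ≤ toℕ (f (a , c)))) →
      WDominating (G ∘ₗ H) (1 ∷ 0 ∷ 0 ∷ []) f
    centers-dominate f token = TokenNear⇒100-dominating (G ∘ₗ H) f λ (x , y) →
      let a , a∈ , 1≤ = token x in (a , c) , center-near y a∈ , 1≤

    lift-secure : WDominating G (2 ∷ 1 ∷ 0 ∷ []) g → SecureWDominating (G ∘ₗ H) (1 ∷ 0 ∷ 0 ∷ []) lift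
    lift-secure dom = centers-dominate lift dominated , defended
      where
      two : ∀ x → TwoTokensNear G x (toℕ ∘ g)
      two = 210-dominating⇒TwoTokensNear G g dom

      dominated : ∀ x → ∃[ a ] (_∈N[_] G a x × 1 ≤ toℕ (lift (a , c)))
      dominated x with a , _ , a∈ , _ , 1≤a , _ ← two x = a , a∈ , positive-at-center 1≤a

      defended : ∀ p → lift p ≡ zero →
        ∃[ q ] (p GH.~ q × zero {2} Fin.< lift q ×
                WDominating (G ∘ₗ H) (1 ∷ 0 ∷ 0 ∷ []) (move (G ∘ₗ H) lift q p))
      defended p@(x , y) lift≡0 with a , a∈ , 1≤a ← dominated x | center-near y a∈
      -- The centre found carries a token, so it cannot be the empty vertex `p`.
      ... | inj₁ refl = contradiction (subst (λ i → 1 ≤ toℕ i) lift≡0 1≤a) λ ()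
      ... | inj₂ p~q  = (a , c) , p~q , 1≤a , centers-dominate (move (G ∘ₗ H) lift (a , c) p) still
        where
        stays : ∀ z → 1 ≤ toℕ (g z) → (z ≡ a → 2 ≤ toℕ (g z)) →
          1 ≤ toℕ (move (G ∘ₗ H) lift (a , c) p (z , c))
        stays z 1≤ 2≤ = ⇒move-positive (G ∘ₗ H) lift (a , c) p (z , c)
          (positive-at-center 1≤) (positive-at-center ∘ 2≤ ∘ cong proj₁)

        still : ∀ z → ∃[ b ] (_∈N[_] G b z × 1 ≤ toℕ (move (G ∘ₗ H) lift (a , c) p (b , c)))
        -- A token at `b₂` away from `a` is untouched by the move. If `b₂` is `a`, use `b₁`: either
        -- it differs from `a`, or both tokens sit at `a` and one of them remains.
        still z with b₁ , b₂ , b₁∈ , b₂∈ , 1≤b₁ , 1≤b₂ , far ← two z | b₂ G.≟ a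
        ... | no  b₂≢a = b₂ , b₂∈ , stays b₂ 1≤b₂ λ b₂≡a → contradiction b₂≡a b₂≢a
        ... | yes b₂≡a = b₁ , b₁∈ , stays b₁ 1≤b₁ λ b₁≡a → far (trans b₁≡a (sym b₂≡a))

  -- Lower bound: capped layer sums.

  module Project (f : V (G ∘ₗ H) → Fin 3) where

    layer : V G → V H → ℕ
    layer x y = toℕ (f (x , y))

    -- Truncation at 2 keeps the tests "at least 1" and "at least 2", which are all that
    -- `TwoTokensNear` sees, and never adds weight.
    cap : ℕ → Fin 3
    cap zero          = zero
    cap (suc zero)    = suc zero
    cap (suc (suc _)) = suc (suc zero)

    cap-≤ : ∀ n → toℕ (cap n) ≤ n
    cap-≤ zero          = z≤n
    cap-≤ (suc zero)    = s≤s z≤n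
    cap-≤ (suc (suc _)) = s≤s (s≤s z≤n)

    cap-≥1 : ∀ {n} → 1 ≤ n → 1 ≤ toℕ (cap n)
    cap-≥1 {suc zero}    _ = s≤s z≤n
    cap-≥1 {suc (suc _)} _ = s≤s z≤n

    cap-≥2 : ∀ {n} → 2 ≤ n → 2 ≤ toℕ (cap n)
    cap-≥2 (s≤s (s≤s _)) = s≤s (s≤s z≤n)

    project : V G → Fin 3
    project x = cap (H.∑V (layer x))

    weight-project : weight G project ≤ weight (G ∘ₗ H) f
    weight-project = ℕ.≤-trans (∑-mono λ i → cap-≤ (H.∑V (layer (G.vertex i))))
      (ℕ.≤-reflexive (sym (∑V-∘ₗ (toℕ ∘ f))))

    -- Tokens in different layers make both layers positive; tokens in one layer sum to at least 2
    -- there, whether spread out or stacked on one vertex.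
    project-tokens : ∀ {u} p q → _∈N[_] G (proj₁ p) u → _∈N[_] G (proj₁ q) u →
      1 ≤ toℕ (f p) → 1 ≤ toℕ (f q) → (p ≡ q → 2 ≤ toℕ (f p)) → TwoTokensNear G u (toℕ ∘ project)
    project-tokens (x , y) (x′ , y′) x∈ x′∈ 1≤p 1≤q far =
      x , x′ , x∈ , x′∈ , one x y 1≤p , one x′ y′ 1≤q , λ where
        refl → cap-≥2 (TwoTokens⇒∑V≥2 H (layer x) (y , y′ , 1≤p , 1≤q , λ { refl → far refl }))
      where
      one : ∀ x y → 1 ≤ toℕ (f (x , y)) → 1 ≤ toℕ (project x)
      one x y 1≤ = cap-≥1 (ℕ.≤-trans 1≤ (term≤∑V H (layer x) y))

    layer-near : ∀ {p q} → _∈N[_] (G ∘ₗ H) q p → _∈N[_] G (proj₁ q) (proj₁ p)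
    layer-near (inj₁ refl)              = inj₁ refl
    layer-near (inj₂ (inj₁ x~x′))       = inj₂ x~x′
    layer-near (inj₂ (inj₂ (refl , _))) = inj₁ refl

    -- An edge within one layer cannot come from `G`, which has no loops.
    near-in-layer : ∀ {u v v′} → v ≢ v′ → _∈N[_] (G ∘ₗ H) (u , v) (u , v′) → v H.~ v′
    near-in-layer v≢v′ (inj₁ refl)              = contradiction refl v≢v′
    near-in-layer v≢v′ (inj₂ (inj₁ u~u))        = contradiction u~u (G.~-irrefl refl)
    near-in-layer v≢v′ (inj₂ (inj₂ (_ , v′~v))) = H.~-sym v′~v

    project-dominating : ¬ Complete H → SecureWDominating (G ∘ₗ H) (1 ∷ 0 ∷ 0 ∷ []) f →
      WDominating G (2 ∷ 1 ∷ 0 ∷ []) project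
    project-dominating incomplete (dom , secure) = TwoTokensNear⇒210-dominating G project two
      where
      complete : ∀ u → ¬ TwoTokensNear G u (toℕ ∘ project) → Complete H
      complete u ¬two v v′ v≢v′ with f (u , v) in eq
      complete u ¬two v v′ v≢v′ | suc _
        with q , q∈ , 1≤q ← 100-dominating⇒TokenNear (G ∘ₗ H) f dom (u , v′)
        -- If the token dominating `(u , v′)` is not the one at `(u , v)`, the two together are two
        -- tokens over N[u].
        with q GH.≟ (u , v)
      ... | yes refl = near-in-layer v≢v′ q∈
      ... | no  q≢uv = contradiction
        (project-tokens q (u , v) (layer-near q∈) (inj₁ refl) 1≤q
          (subst (λ i → 1 ≤ toℕ i) (sym eq) (s≤s z≤n)) λ q≡uv → contradiction q≡uv q≢uv)
        ¬two
      complete u ¬two v v′ v≢v′ | zero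
        with r , uv~r , 1≤r , dom′ ← secure (u , v) eq
        with q , q∈ , 1≤q ← 100-dominating⇒TokenNear (G ∘ₗ H) _ dom′ (u , v′)
        -- Unless `q` is the arrival point `(u , v)`, it was positive before the move. With the
        -- defender `r` it then gives two tokens over N[u], stacked if `q` is `r`.
        with move-positive⇒ (G ∘ₗ H) f r (u , v) q 1≤q
      ... | inj₁ refl       = near-in-layer v≢v′ q∈
      ... | inj₂ (1≤q , 2≤q) = contradiction
        (project-tokens q r (layer-near q∈) (layer-near (inj₂ uv~r)) 1≤q 1≤r 2≤q) ¬two

      two : ∀ u → TwoTokensNear G u (toℕ ∘ project)
      -- `incomplete` names no nonadjacent pair, so the argument is by contraposition; deciding the
      -- inequality is what yields actual tokens.
      two u with 2 ℕ.≤? toℕ (project u) + G.∑N u (toℕ ∘ project)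
      ... | yes 2≤ = closed-sum≥2⇒TwoTokensNear G u (toℕ ∘ project) 2≤
      ... | no  2≰ = contradiction
        (complete u (2≰ ∘ TwoTokensNear⇒closed-sum≥2 G u (toℕ ∘ project))) incomplete

theorem15 : (G H : Graph) → NoIsolatedVertex G → ¬ Complete H → IsDominationNumber H 1 →
    ∃[ m ] (IsSecureWDominationNumber (G ∘ₗ H) (1 ∷ 0 ∷ 0 ∷ []) m
    × IsWDominationNumber G (2 ∷ 1 ∷ 0 ∷ []) m)
theorem15 G H _ incomplete γH≡1
  with c , universal ← universal-vertex H γH≡1
  with m , isMin@((g , dom , weight≡m) , minimal) ← 210-domination-number G =
  m , ((lift , lift-secure dom , trans weight-lift weight≡m) , lower) , isMin
  where
  open Lift G H c universal g
  lower : ∀ f → SecureWDominating (G ∘ₗ H) (1 ∷ 0 ∷ 0 ∷ []) f → m ≤ weight (G ∘ₗ H) f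
  lower f secure = ℕ.≤-trans (minimal project (project-dominating incomplete secure)) weight-project
    where open Project G H f
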